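{- Let $n$ and $k$ be positive integers and let $x$ be a soldier in the Texas Chainsaw Josephus Game with $n$ soldiers and parameter $k$, so $0\le x\le n-1$. (1) If $x=(k+1)m+s$ with $m\ge 0$ an integer and $1\le s\le k$, then soldier $x$ is eliminated after $x-m$ seconds. (2) If $x=(k+1)m$ with $m\ge 0$ an integer, then there exist unique nonnegative integers $a$ and $b$ such that $n-km=a(k+1)^b$ and $a\not\equiv 0 \pmod{k+1}$. Dividing $a$ by $k+1$, write $a=(k+1)q+r$ with $q, r$ integers and $0<r<k+1$. Then soldier $x$ is eliminated after $n-q$ seconds.
   Context: Texas Chainsaw Josephus Game with $n$ soldiers and parameter $k\ge 1$: soldiers labeled $0,1,\dots,n-1$ stand in a circle in this cyclic order. Starting with soldier $0$, the soldiers still in the circle are visited one at a time in cyclic order of increasing label (after the largest remaining label comes the smallest remaining label). Number the visits $0,1,2,\dots$. At visit $j$, the visited soldier is skipped (stays in the circle) if $j\equiv 0 \pmod{k+1}$, and is eliminated (removed from the circle) otherwise. In other words, one soldier is skipped, then $k$ consecutive soldiers are eliminated, and this repeats. The game continues until one soldier remains. Time convention: "eliminated after $t$ seconds" means that the soldier is the $t$-th one in the elimination order, i.e. each elimination takes one second and skips take no time. The last remaining soldier (the survivor) is regarded as being eliminated last, i.e. after $n$ seconds. For example, for $n=10$, $k=2$ the elimination order is $1,2,4,5,7,8,0,3,9,6$, where $6$ is the survivor. -}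

module Defs where

open import Data.Empty using (⊥-elim)
open import Data.Fin using (Fin; toℕ)
open import Data.List using (List; []; _∷_; _∷ʳ_; allFin; length; lookup)
open import Data.Nat using (ℕ; suc; _%_)
open import Data.Product using (∃; Σ-syntax; _×_)
open import Relation.Binary.PropositionalEquality using (_≡_; _≢_; refl; cong)

-- Play k j circle order: when visit number j is about to take place and the
-- remaining soldiers, in cyclic order starting with the one to be visited
-- next, are `circle`, the rest of the game removes them in the order `order`,
-- whose last entry is the survivor.  A skipped soldier moves to the back of
-- the list.
data Play (k : ℕ) {A : Set} : ℕ → List A → List A → Set where
  survivor  : ∀ {j x} → Play k j (x ∷ []) (x ∷ [])
  skip      : ∀ {j x y ys order} → j % suc k ≡ 0 →
              Play k (suc j) ((y ∷ ys) ∷ʳ x) order →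
              Play k j (x ∷ y ∷ ys) order
  eliminate : ∀ {j x y ys order} → j % suc k ≢ 0 →
              Play k (suc j) (y ∷ ys) order →
              Play k j (x ∷ y ∷ ys) (x ∷ order)

Play-deterministic : ∀ {k j} {A : Set} {circle order order′ : List A} →
  Play k j circle order → Play k j circle order′ → order ≡ order′
Play-deterministic survivor         survivor         = refl
Play-deterministic (skip _ p)       (skip _ p′)      = Play-deterministic p p′
Play-deterministic (skip e _)       (eliminate ne _) = ⊥-elim (ne e)
Play-deterministic (eliminate ne _) (skip e _)       = ⊥-elim (ne e)
Play-deterministic (eliminate _ p)  (eliminate _ p′) = cong (_ ∷_) (Play-deterministic p p′)

EliminationOrder : (n k : ℕ) → List (Fin n) → Set
EliminationOrder n k order = Play k 0 (allFin n) order

-- Seconds are counted from 1, list positions from 0.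
EliminatedAfter : (n k : ℕ) → Fin n → ℕ → Set
EliminatedAfter n k x t =
  ∃ λ order → EliminationOrder n k order ×
    (Σ[ i ∈ Fin (length order) ] (lookup order i ≡ x × suc (toℕ i) ≡ t))

{-# OPTIONS --safe #-}

-- A soldier skipped at visit j, with c soldiers left in the circle, is next
-- visited at visit j + c.  Before visit (k+1)m there have been m skips, so
-- c = n − km there, and the next visit is (k+1)m + c.  If k + 1 divides c, that
-- visit is again a skip, with c / (k+1) soldiers left: the factor a of
-- c = a(k+1)^b is kept and b drops by one.  Once b = 0, the soldier is
-- eliminated with q others left, where q is the quotient of a by k + 1.
module Submission where

open import Data.Fin as Fin using (Fin; toℕ)
open import Data.Fin.Properties using (toℕ<n)
open import Data.List using (List; []; _∷_; _∷ʳ_; _++_; length; lookup; tabulate; allFin)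
open import Data.List.Properties using (++-assoc; length-++; length-tabulate)
open import Data.Nat using (ℕ; zero; suc; _+_; _*_; _∸_; _^_; _/_; _%_; _≤_; _<_; z<s; s<s; s<s⁻¹; NonZero; >-nonZero; >-nonZero⁻¹)
open import Data.Nat.DivMod
open import Data.Nat.Induction using (<-rec)
open import Data.Nat.Properties
open import Data.Nat.Tactic.RingSolver using (solve-∀)
open import Data.Product using (_×_; _,_; ∃; ∃!; ∃₂)
open import Function using (id; _∘_)
open import Relation.Binary.PropositionalEquality using (_≡_; _≢_; refl; sym; trans; cong; cong₂; subst; module ≡-Reasoning)
open import Relation.Nullary using (yes; no; contradiction)
open import Defs

open ≡-Reasoning

private
  variable
    A : Set
    k j : ℕ

-- Division with remainder and the count of skips.

[m+n*d]%d≡m : ∀ m n d .{{_ : NonZero d}} → m < d → (m + n * d) % d ≡ m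
[m+n*d]%d≡m m n d m<d = trans ([m+kn]%n≡m%n m n d) (m<n⇒m%n≡m m<d)

[m+n*d]/d≡n : ∀ m n d .{{_ : NonZero d}} → m < d → (m + n * d) / d ≡ n
[m+n*d]/d≡n m n d m<d = *-cancelʳ-≡ _ n d (+-cancelˡ-≡ m _ _ (begin
  m + (m + n * d) / d * d                ≡⟨ cong (_+ (m + n * d) / d * d) ([m+n*d]%d≡m m n d m<d) ⟨
  (m + n * d) % d + (m + n * d) / d * d  ≡⟨ m≡m%n+[m/n]*n (m + n * d) d ⟨
  m + n * d                              ∎))

m%d≡0⇒m≡[m/d]*d : ∀ m d .{{_ : NonZero d}} → m % d ≡ 0 → m ≡ m / d * d
m%d≡0⇒m≡[m/d]*d m d m%d≡0 = trans (m≡m%n+[m/n]*n m d) (cong (_+ m / d * d) m%d≡0)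

-- The ceiling of `j / suc k`: the number of multiples of `suc k` below `j`, hence of skips before
-- visit `j`.
skips : ℕ → ℕ → ℕ
skips k j = (j + k) / suc k

skips-multiple : ∀ k m → skips k (m * suc k) ≡ m
skips-multiple k m = trans (cong (_/ suc k) (+-comm (m * suc k) k)) ([m+n*d]/d≡n k m (suc k) ≤-refl)

-- The case `s = k` is included: there the visit is the next multiple of `suc k`, whose own skip has
-- not happened yet.
skips-between : ∀ k m s → s < suc k → skips k (suc s + m * suc k) ≡ suc m
skips-between k m s s<1+k = trans (cong (_/ suc k) (eq s k m)) ([m+n*d]/d≡n s (suc m) (suc k) s<1+k)
  where
  eq : ∀ s k m → suc s + m * suc k + k ≡ s + suc m * suc k
  eq = solve-∀

skips-after-skip : ∀ k j → j % suc k ≡ 0 → skips k (suc j) ≡ suc (skips k j)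
skips-after-skip k j j%≡0 = begin
  skips k (suc j)                  ≡⟨ cong (skips k ∘ suc) j≡ ⟩
  skips k (suc (j / suc k * suc k)) ≡⟨ skips-between k (j / suc k) 0 z<s ⟩
  suc (j / suc k)                  ≡⟨ cong suc (skips-multiple k (j / suc k)) ⟨
  suc (skips k (j / suc k * suc k)) ≡⟨ cong (suc ∘ skips k) j≡ ⟨
  suc (skips k j)                  ∎
  where
  j≡ : j ≡ j / suc k * suc k
  j≡ = m%d≡0⇒m≡[m/d]*d j (suc k) j%≡0

skips-after-elimination : ∀ k j → j % suc k ≢ 0 → skips k (suc j) ≡ skips k j
skips-after-elimination k j j%≢0 with j % suc k | m≡m%n+[m/n]*n j (suc k) | m%n<n j (suc k)
... | zero  | _  | _   = contradiction refl j%≢0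
... | suc s | j≡ | s<k = begin
  skips k (suc j)                           ≡⟨ cong (skips k ∘ suc) j≡ ⟩
  skips k (suc (suc s) + j / suc k * suc k) ≡⟨ skips-between k (j / suc k) (suc s) s<k ⟩
  suc (j / suc k)                           ≡⟨ skips-between k (j / suc k) s (<-trans ≤-refl s<k) ⟨
  skips k (suc s + j / suc k * suc k)       ≡⟨ cong (skips k) j≡ ⟨
  skips k j                                 ∎

-- With `k` positive, a skip is always followed by a visit that is not a skip, so play cannot stall;
-- `Play-total` relies on this.
suc-%≢0 : ∀ k j .{{_ : NonZero k}} → j % suc k ≡ 0 → suc j % suc k ≢ 0
suc-%≢0 k j j%≡0 1+j%≡0 = contradiction (trans (sym 1+j%≡1) 1+j%≡0) (λ ())
  where
  1+j%≡1 : suc j % suc k ≡ 1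
  1+j%≡1 = begin
    suc j % suc k                   ≡⟨ cong (λ i → suc i % suc k) (m%d≡0⇒m≡[m/d]*d j (suc k) j%≡0) ⟩
    (1 + j / suc k * suc k) % suc k ≡⟨ [m+n*d]%d≡m 1 (j / suc k) (suc k) (s<s (>-nonZero⁻¹ k)) ⟩
    1                               ∎

-- Single moves and the existence of a complete play.

length-∷ʳ : ∀ (xs : List A) x → length (xs ∷ʳ x) ≡ suc (length xs)
length-∷ʳ xs x = trans (length-++ xs) (+-comm (length xs) 1)

Play-length : ∀ {circle order : List A} → Play k j circle order → length order ≡ length circle
Play-length survivor                                  = refl
Play-length (skip {x = x} {y = y} {ys = ys} _ p)      = trans (Play-length p) (length-∷ʳ (y ∷ ys) x)
Play-length (eliminate _ p)                           = cong suc (Play-length p)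

-- The constructor `skip` needs the second soldier in view, so `pre` is split only to expose it;
-- `eliminate-head` does the same for `eliminate`.
skip-head : ∀ {z y : A} {order} pre {suf} → j % suc k ≡ 0 →
  Play k (suc j) (pre ++ y ∷ (suf ∷ʳ z)) order → Play k j (z ∷ pre ++ y ∷ suf) order
skip-head [] j%≡0 p = skip j%≡0 p
skip-head {j = j} {k = k} {z = z} {y} {order} (w ∷ pre) {suf} j%≡0 p =
  skip j%≡0 (subst (λ c → Play k (suc j) c order) (cong (w ∷_) (sym (++-assoc pre (y ∷ suf) (z ∷ [])))) p)

eliminate-head : ∀ {z y : A} {order} pre {suf} → j % suc k ≢ 0 →
  Play k (suc j) (pre ++ y ∷ suf) order → Play k j (z ∷ pre ++ y ∷ suf) (z ∷ order)
eliminate-head []        = eliminate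
eliminate-head (_ ∷ pre) = eliminate

-- A skip leaves the length unchanged, so the recursion on `l` takes it together with the
-- elimination that must follow.
Play-total : .{{_ : NonZero k}} → ∀ l j (circle : List A) → length circle ≡ suc l → ∃ (Play k j circle)
Play-total l j (x ∷ []) _ = x ∷ [] , survivor
Play-total {k = k} (suc l) j (x ∷ y ∷ ys) len with j % suc k ≟ 0
... | no j%≢0 =
  let order , p = Play-total l (suc j) (y ∷ ys) (suc-injective len)
  in x ∷ order , eliminate j%≢0 p
... | yes j%≡0 =
  let order , p = Play-total l (2 + j) (ys ∷ʳ x) (trans (length-∷ʳ ys x) (suc-injective len))
  in y ∷ order , skip j%≡0 (eliminate-head ys (suc-%≢0 k j j%≡0) p)

-- Following one soldier until its removal.

-- Counting the soldiers removed after x, rather than before, gives a number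
-- that does not change as the play proceeds.
RemovedWithRemaining : (k j : ℕ) → List A → A → ℕ → Set
RemovedWithRemaining k j circle x r = ∃₂ λ us vs → Play k j circle (us ++ x ∷ vs) × length vs ≡ r

-- The `j` visits so far are `skips k j` skips and `n - length circle` eliminations; rearranged to
-- avoid subtraction.
Balanced : (n k j : ℕ) → List A → Set
Balanced n k j circle = length circle + j ≡ n + skips k j

module _ (n : ℕ) where

  Balanced-skip : ∀ {z y : A} pre {suf} → j % suc k ≡ 0 →
    Balanced n k j (z ∷ pre ++ y ∷ suf) → Balanced n k (suc j) (pre ++ y ∷ (suf ∷ʳ z))
  Balanced-skip {j = j} {k = k} {z = z} {y} pre {suf} j%≡0 bal = begin
    length (pre ++ y ∷ (suf ∷ʳ z)) + suc j   ≡⟨ cong (λ c → length c + suc j) (++-assoc pre (y ∷ suf) (z ∷ [])) ⟨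
    length ((pre ++ y ∷ suf) ∷ʳ z) + suc j   ≡⟨ cong (_+ suc j) (length-∷ʳ (pre ++ y ∷ suf) z) ⟩
    length (z ∷ pre ++ y ∷ suf) + suc j      ≡⟨ +-suc _ j ⟩
    suc (length (z ∷ pre ++ y ∷ suf) + j)    ≡⟨ cong suc bal ⟩
    suc (n + skips k j)                      ≡⟨ +-suc n _ ⟨
    n + suc (skips k j)                      ≡⟨ cong (n +_) (skips-after-skip k j j%≡0) ⟨
    n + skips k (suc j)                      ∎

  Balanced-eliminate : ∀ {z : A} {circle} → j % suc k ≢ 0 →
    Balanced n k j (z ∷ circle) → Balanced n k (suc j) circle
  Balanced-eliminate {j = j} {k = k} {circle = circle} j%≢0 bal = begin
    length circle + suc j ≡⟨ +-suc _ j ⟩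
    suc (length circle + j) ≡⟨ bal ⟩
    n + skips k j         ≡⟨ cong (n +_) (skips-after-elimination k j j%≢0) ⟨
    n + skips k (suc j)   ∎

  -- Visiting all of `pre` brings `x` to the front. Who then stands behind `x` depends on the skips
  -- made on the way, so `front` must handle every `suf′`; balance still determines its length.
  advance : ∀ {x : A} {r} pre {suf} → Balanced n k j (pre ++ x ∷ suf) →
    (∀ suf′ → Balanced n k (length pre + j) (x ∷ suf′) →
      RemovedWithRemaining k (length pre + j) (x ∷ suf′) x r) →
    RemovedWithRemaining k j (pre ++ x ∷ suf) x r
  advance [] bal front = front _ bal
  advance {k = k} {j = j} {x = x} {r} (z ∷ pre) bal front
    with j % suc k ≟ 0
       | subst (λ i → ∀ suf′ → Balanced n k i (x ∷ suf′) → RemovedWithRemaining k i (x ∷ suf′) x r)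
           (sym (+-suc (length pre) j)) front
  ... | yes j%≡0 | front′ =
    let us , vs , p , len = advance pre (Balanced-skip pre j%≡0 bal) front′
    in us , vs , skip-head pre j%≡0 p , len
  ... | no j%≢0 | front′ =
    let us , vs , p , len = advance pre (Balanced-eliminate {z = z} {circle = pre ++ x ∷ _} j%≢0 bal) front′
    in z ∷ us , vs , eliminate-head pre j%≢0 p , len

-- All of `suf` outlasts `x`, and a complete play always exists. A lone soldier is the survivor,
-- removed with nobody left.
removed-at-head : .{{_ : NonZero k}} → ∀ {x : A} suf → j % suc k ≢ 0 →
  RemovedWithRemaining k j (x ∷ suf) x (length suf)
removed-at-head [] _ = [] , [] , survivor , refl
removed-at-head {j = j} (y ∷ ys) j%≢0 =
  let order , p = Play-total (length ys) (suc j) (y ∷ ys) refl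
  in [] , order , eliminate j%≢0 p , Play-length p

-- There have been `suc m` skips; the extra one offsets `x` itself in the length of the circle. The
-- bound `s < k` keeps `j` strictly between two multiples of `suc k`, so this visit is not a skip.
removed-between-multiples : .{{_ : NonZero k}} → ∀ n m s {x : A} suf → s < k →
  j ≡ suc s + m * suc k → Balanced n k j (x ∷ suf) →
  length suf + j ≡ n + m × RemovedWithRemaining k j (x ∷ suf) x (length suf)
removed-between-multiples {k = k} n m s suf s<k refl bal =
  suc-injective (trans bal (trans (cong (n +_) (skips-between k m s (m<n⇒m<1+n s<k))) (+-suc n m))) ,
  removed-at-head suf λ %≡0 → contradiction (trans (sym ([m+n*d]%d≡m (suc s) m (suc k) (s<s s<k))) %≡0) λ ()

-- Recursion on `b`: each round trip of `x` from one skip to the next divides the length of the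
-- circle by `suc k`.
removed-after-skips : .{{_ : NonZero k}} → ∀ n m a b q s {x : A} suf → s < k →
  a ≡ suc s + q * suc k → length (x ∷ suf) ≡ a * suc k ^ b →
  Balanced n k (m * suc k) (x ∷ suf) →
  RemovedWithRemaining k (m * suc k) (x ∷ suf) x q
-- Here `1 ≡ a * suc k ^ b` forces `a ≡ 1`, hence `q ≡ 0`, which agrees with the survivor being
-- removed last.
removed-after-skips {k = k} n m a b q s {x} [] s<k a≡ len bal = [] , [] , survivor , sym q≡0
  where
  q*d≡0 : q * suc k ≡ 0
  q*d≡0 = m+n≡0⇒n≡0 s (suc-injective (trans (sym a≡) (m*n≡1⇒m≡1 a (suc k ^ b) (sym len))))
  q≡0 : q ≡ 0
  q≡0 = m*n≡0⇒m≡0 q (suc k) q*d≡0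
removed-after-skips {k = k} n m a b q s {x} suf@(y ∷ ys) s<k a≡ len bal =
  -- The skip puts `x` at the very back, so all of `suf` is visited before `x` returns to the front.
  let us , vs , p , len′ = advance n suf {suf = []} (Balanced-skip n {z = x} {y = y} [] {suf = ys} m%≡0 bal) (front b len)
  in us , vs , skip m%≡0 p , len′
  where
  m%≡0 : (m * suc k) % suc k ≡ 0
  m%≡0 = m*n%n≡0 m (suc k)

  visit = length suf + suc (m * suc k)

  n+m≡ : n + m ≡ visit
  n+m≡ = trans (cong (n +_) (sym (skips-multiple k m))) (trans (sym bal) (sym (+-suc (length suf) (m * suc k))))

  front : ∀ b → length (x ∷ suf) ≡ a * suc k ^ b → ∀ suf′ → Balanced n k visit (x ∷ suf′) →
    RemovedWithRemaining k visit (x ∷ suf′) x q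
  -- The circle had length `a`, so `x` returns at a visit with remainder `suc s` and quotient
  -- `m + q`. Comparing `n + (m + q)` with `visit ≡ n + m` leaves exactly `q` soldiers behind `x`.
  front zero len suf′ bal′ =
    let eq , removed = removed-between-multiples n (m + q) s suf′ s<k visit≡ bal′
    in subst (RemovedWithRemaining k visit (x ∷ suf′) x) (+-cancelʳ-≡ visit _ _ (trans eq n+[m+q]≡)) removed
    where
    visit≡ : visit ≡ suc s + (m + q) * suc k
    visit≡ = begin
      length suf + suc (m * suc k)        ≡⟨ +-suc (length suf) (m * suc k) ⟩
      length (x ∷ suf) + m * suc k        ≡⟨ cong (_+ m * suc k) (trans len (trans (*-identityʳ a) a≡)) ⟩
      suc s + q * suc k + m * suc k       ≡⟨ lemma s q m k ⟩
      suc s + (m + q) * suc k             ∎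
      where
      lemma : ∀ s q m k → suc s + q * suc k + m * suc k ≡ suc s + (m + q) * suc k
      lemma = solve-∀
    n+[m+q]≡ : n + (m + q) ≡ q + visit
    n+[m+q]≡ = trans (sym (+-assoc n m q)) (trans (cong (_+ q) n+m≡) (+-comm visit q))
  front (suc b) len suf′ bal′ =
    subst (λ i → RemovedWithRemaining k i (x ∷ suf′) x q) (sym visit≡)
      (removed-after-skips n m′ a b q s suf′ s<k a≡ len′ (subst (λ i → Balanced n k i (x ∷ suf′)) visit≡ bal′))
    where
    -- The old length divided by `suc k`, which is also the number of skips during the round trip,
    -- counting that of `x`.
    c′ = a * suc k ^ b
    m′ = m + c′
    visit≡ : visit ≡ m′ * suc k
    visit≡ = begin
      length suf + suc (m * suc k)          ≡⟨ +-suc (length suf) (m * suc k) ⟩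
      length (x ∷ suf) + m * suc k          ≡⟨ cong (_+ m * suc k) len ⟩
      a * (suc k * suc k ^ b) + m * suc k   ≡⟨ lemma a k (suc k ^ b) m ⟩
      m′ * suc k                            ∎
      where
      lemma : ∀ a k d m → a * (suc k * d) + m * suc k ≡ (m + a * d) * suc k
      lemma = solve-∀
    -- Balance makes the new length plus `visit` equal to `n + m + c′`, and `visit` is `n + m`.
    len′ : length (x ∷ suf′) ≡ c′
    len′ = +-cancelʳ-≡ visit _ _ (begin
      length (x ∷ suf′) + visit ≡⟨ bal′ ⟩
      n + skips k visit         ≡⟨ cong (n +_) (trans (cong (skips k) visit≡) (skips-multiple k m′)) ⟩
      n + (m + c′)              ≡⟨ +-assoc n m c′ ⟨
      n + m + c′                ≡⟨ cong (_+ c′) n+m≡ ⟩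
      visit + c′                ≡⟨ +-comm visit c′ ⟩
      c′ + visit                ∎)

-- From the number of soldiers remaining to elimination times.

tabulate-split : ∀ {n} (f : Fin n → A) x →
  ∃₂ λ pre suf → tabulate f ≡ pre ++ f x ∷ suf × length pre ≡ toℕ x
tabulate-split f Fin.zero    = [] , _ , refl , refl
tabulate-split f (Fin.suc x) =
  let pre , suf , eq , len = tabulate-split (f ∘ Fin.suc) x
  in f Fin.zero ∷ pre , suf , cong (f Fin.zero ∷_) eq , cong suc len

lookup-middle : ∀ us {x : A} {vs} →
  ∃ λ (i : Fin (length (us ++ x ∷ vs))) → lookup (us ++ x ∷ vs) i ≡ x × toℕ i ≡ length us
lookup-middle []       = Fin.zero , refl , refl
lookup-middle (_ ∷ us) =
  let i , eq , len = lookup-middle us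
  in Fin.suc i , eq , cong suc len

eliminatedAfter : ∀ n k (x : Fin n) {r t} → t + r ≡ n →
  RemovedWithRemaining k 0 (allFin n) x r → EliminatedAfter n k x t
eliminatedAfter n k x {r} {t} t+r≡n (us , vs , p , len) =
  let i , eq , toℕ≡ = lookup-middle us
  in us ++ x ∷ vs , p , i , eq , trans (cong suc toℕ≡) (+-cancelʳ-≡ r _ _ total)
  where
  total : suc (length us) + r ≡ t + r
  total = begin
    suc (length us) + r            ≡⟨ cong (suc (length us) +_) len ⟨
    suc (length us + length vs)    ≡⟨ +-suc (length us) (length vs) ⟨
    length us + length (x ∷ vs)    ≡⟨ length-++ us ⟨
    length (us ++ x ∷ vs)          ≡⟨ Play-length p ⟩
    length (allFin n)              ≡⟨ length-tabulate id ⟩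
    n                              ≡⟨ t+r≡n ⟨
    t + r                          ∎

-- In the first round labels and visit numbers coincide: exactly `toℕ x` soldiers stand ahead of
-- `x`, each visited once.
first-visit : ∀ n k (x : Fin n) {r j} → toℕ x ≡ j →
  (∀ suf → Balanced n k j (x ∷ suf) → RemovedWithRemaining k j (x ∷ suf) x r) →
  RemovedWithRemaining k 0 (allFin n) x r
first-visit n k x {r} refl front with tabulate-split id x
... | pre , suf , split , len =
  subst (λ c → RemovedWithRemaining k 0 c x r) (sym split)
    (advance n pre (subst (Balanced n k 0) split initial)
      (subst (λ i → ∀ suf′ → Balanced n k i (x ∷ suf′) → RemovedWithRemaining k i (x ∷ suf′) x r)
        (sym (trans (+-identityʳ _) len)) front))
  where
  initial : Balanced n k 0 (allFin n)
  initial = cong₂ _+_ (length-tabulate id) (sym (skips-multiple k 0))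

-- Splitting off the powers of a divisor.

power-factorisation : ∀ d .{{_ : NonZero d}} → 1 < d → ∀ N → 0 < N →
  ∃₂ λ a b → N ≡ a * d ^ b × a % d ≢ 0
power-factorisation d 1<d = <-rec _ λ N rec 0<N → go N rec 0<N
  where
  go : ∀ N → (∀ {M} → M < N → 0 < M → ∃₂ λ a b → M ≡ a * d ^ b × a % d ≢ 0) →
       0 < N → ∃₂ λ a b → N ≡ a * d ^ b × a % d ≢ 0
  go N rec 0<N with N % d ≟ 0
  ... | no N%≢0 = N , 0 , sym (*-identityʳ N) , N%≢0
  ... | yes N%≡0 =
    let a , b , eq , a%≢0 = rec N/d<N 0<N/d
    in a , suc b , trans N≡ (trans (cong (_* d) eq) (lemma a (d ^ b) d)) , a%≢0
    where
    lemma : ∀ a e d → a * e * d ≡ a * (d * e)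
    lemma = solve-∀
    N≡ : N ≡ N / d * d
    N≡ = m%d≡0⇒m≡[m/d]*d N d N%≡0
    N/d<N : N / d < N
    N/d<N = m/n<m N d {{>-nonZero 0<N}} 1<d
    0<N/d : 0 < N / d
    0<N/d = n≢0⇒n>0 λ N/d≡0 → <⇒≢ 0<N (sym (trans N≡ (cong (_* d) N/d≡0)))

-- Common factors `d` cancel until one exponent is zero; a positive exponent left on the other side
-- would make a coefficient divisible by `d`.
power-factorisation-unique : ∀ d .{{_ : NonZero d}} {a a′} b b′ → a % d ≢ 0 → a′ % d ≢ 0 →
  a * d ^ b ≡ a′ * d ^ b′ → (a , b) ≡ (a′ , b′)
power-factorisation-unique d {a} {a′} = go
  where
  shift : ∀ a b → a * d ^ suc b ≡ a * d ^ b * d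
  shift a b = trans (cong (a *_) (*-comm d (d ^ b))) (sym (*-assoc a (d ^ b) d))
  multiple : ∀ a a′ b → a * 1 ≡ a′ * d ^ suc b → a % d ≡ 0
  multiple a a′ b eq = trans (cong (_% d) (trans (sym (*-identityʳ a)) (trans eq (shift a′ b))))
                             (m*n%n≡0 (a′ * d ^ b) d)
  go : ∀ b b′ → a % d ≢ 0 → a′ % d ≢ 0 → a * d ^ b ≡ a′ * d ^ b′ → (a , b) ≡ (a′ , b′)
  go zero    zero     _    _     eq = cong (_, 0) (*-cancelʳ-≡ a a′ 1 eq)
  go zero    (suc b′) a%≢0 _     eq = contradiction (multiple a a′ b′ eq) a%≢0
  go (suc b) zero     _    a′%≢0 eq = contradiction (multiple a′ a b (sym eq)) a′%≢0
  go (suc b) (suc b′) a%≢0 a′%≢0 eq =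
    cong (λ (c , e) → c , suc e)
      (go b b′ a%≢0 a′%≢0 (*-cancelʳ-≡ _ _ d (trans (sym (shift a b)) (trans eq (shift a′ b′)))))

theorem3 : (n k : ℕ) .{{_ : NonZero n}} .{{_ : NonZero k}} (x : Fin n) →
    (∀ m s → toℕ x ≡ suc k * m + s → 1 ≤ s → s ≤ k →
    EliminatedAfter n k x (toℕ x ∸ m))
    ×
    (∀ m → toℕ x ≡ suc k * m →
    (∃! _≡_ λ ((a , b) : ℕ × ℕ) →
    n ∸ k * m ≡ a * suc k ^ b × a % suc k ≢ 0)
    ×
    (∀ a b → n ∸ k * m ≡ a * suc k ^ b → a % suc k ≢ 0 →
    (∃₂ λ q r → a ≡ suc k * q + r × 0 < r × r < suc k)
    ×
    (∀ q r → a ≡ suc k * q + r → 0 < r → r < suc k →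
    EliminatedAfter n k x (n ∸ q))))
theorem3 n k x = part₁ , λ m x≡ → factorisation m x≡ , λ a b N≡ a%≢0 → division a a%≢0 , part₂ m a b x≡ N≡
  where
  x<n : toℕ x < n
  x<n = toℕ<n x

  commute : ∀ m s → suc k * m + s ≡ s + m * suc k
  commute m s = trans (+-comm _ s) (cong (s +_) (*-comm (suc k) m))

  part₁ : ∀ m s → toℕ x ≡ suc k * m + s → 1 ≤ s → s ≤ k → EliminatedAfter n k x (toℕ x ∸ m)
  part₁ m (suc s) x≡ _ s<k = eliminatedAfter n k x total (first-visit n k x x≡′ front)
    where
    x≡′ : toℕ x ≡ suc s + m * suc k
    x≡′ = trans x≡ (commute m (suc s))
    m≤x : m ≤ toℕ x
    m≤x = ≤-trans (≤-trans (m≤m*n m (suc k)) (m≤n+m (m * suc k) (suc s))) (≤-reflexive (sym x≡′))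
    -- Removal after `toℕ x ∸ m` seconds leaves `n - (x - m)` soldiers; in this form `x < n` rules
    -- out truncation.
    r = n + m ∸ toℕ x
    front : ∀ suf → Balanced n k (suc s + m * suc k) (x ∷ suf) →
      RemovedWithRemaining k (suc s + m * suc k) (x ∷ suf) x r
    front suf bal =
      let eq , removed = removed-between-multiples n m s suf s<k refl bal
      in subst (RemovedWithRemaining k _ (x ∷ suf) x)
           (trans (sym (m+n∸n≡m (length suf) (toℕ x))) (cong (_∸ toℕ x) (trans (cong (length suf +_) x≡′) eq)))
           removed
    total : toℕ x ∸ m + r ≡ n
    total = +-cancelʳ-≡ m _ _ (begin
      toℕ x ∸ m + r + m   ≡⟨ swap (toℕ x ∸ m) r m ⟩
      toℕ x ∸ m + m + r   ≡⟨ cong (_+ r) (m∸n+n≡m m≤x) ⟩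
      toℕ x + r           ≡⟨ m+[n∸m]≡n (≤-trans (<⇒≤ x<n) (m≤m+n n m)) ⟩
      n + m               ∎)
      where
      swap : ∀ p q r → p + q + r ≡ p + r + q
      swap = solve-∀

  0<N : ∀ m → toℕ x ≡ suc k * m → 0 < n ∸ k * m
  -- The chain is `k * m ≤ suc k * m ≡ toℕ x < n`.
  0<N m x≡ = m<n⇒0<n∸m (≤-<-trans (≤-trans (m≤n+m (k * m) m) (≤-reflexive (sym x≡))) x<n)

  factorisation : ∀ m → toℕ x ≡ suc k * m →
    ∃! _≡_ λ ((a , b) : ℕ × ℕ) → n ∸ k * m ≡ a * suc k ^ b × a % suc k ≢ 0
  factorisation m x≡ =
    let a , b , N≡ , a%≢0 = power-factorisation (suc k) (s<s (>-nonZero⁻¹ k)) (n ∸ k * m) (0<N m x≡)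
    in (a , b) , (N≡ , a%≢0) , λ {(a′ , b′)} (N≡′ , a′%≢0) →
         power-factorisation-unique (suc k) b b′ a%≢0 a′%≢0 (trans (sym N≡) N≡′)

  division : ∀ a → a % suc k ≢ 0 → ∃₂ λ q r → a ≡ suc k * q + r × 0 < r × r < suc k
  division a a%≢0 =
    a / suc k , a % suc k ,
    trans (m≡m%n+[m/n]*n a (suc k)) (sym (commute (a / suc k) (a % suc k))) ,
    n≢0⇒n>0 a%≢0 , m%n<n a (suc k)

  part₂ : ∀ m a b → toℕ x ≡ suc k * m → n ∸ k * m ≡ a * suc k ^ b →
    ∀ q r → a ≡ suc k * q + r → 0 < r → r < suc k → EliminatedAfter n k x (n ∸ q)
  part₂ m a b x≡ N≡ q (suc s) a≡ _ s<k =
    eliminatedAfter n k x (m∸n+n≡m q≤n) (first-visit n k x (trans x≡ (*-comm (suc k) m)) front)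
    where
    a≡′ : a ≡ suc s + q * suc k
    a≡′ = trans a≡ (commute q (suc s))
    q≤n : q ≤ n
    q≤n = ≤-trans (m≤m*n q (suc k))
         (≤-trans (m≤n+m (q * suc k) (suc s))
         (≤-trans (≤-reflexive (sym a≡′))
         (≤-trans (m≤m*n a (suc k ^ b) {{m^n≢0 (suc k) b}})
         (≤-trans (≤-reflexive (sym N≡)) (m∸n≤m n (k * m))))))
    front : ∀ suf → Balanced n k (m * suc k) (x ∷ suf) →
      RemovedWithRemaining k (m * suc k) (x ∷ suf) x q
    front suf bal = removed-after-skips n m a b q s suf (s<s⁻¹ s<k) a≡′ (trans len N≡) bal
      where
      lemma : ∀ l m k → l + k * m + m ≡ l + m * suc k
      lemma = solve-∀
      -- Balance at the first visit gives length plus `m * suc k` equal to `n + m`; cancelling `m`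
      -- leaves length plus `k * m` equal to `n`.
      len : length (x ∷ suf) ≡ n ∸ k * m
      len = trans (sym (m+n∸n≡m (length (x ∷ suf)) (k * m))) (cong (_∸ k * m) (+-cancelʳ-≡ m _ _ (begin
        length (x ∷ suf) + k * m + m   ≡⟨ lemma (length (x ∷ suf)) m k ⟩
        length (x ∷ suf) + m * suc k   ≡⟨ bal ⟩
        n + skips k (m * suc k)        ≡⟨ cong (n +_) (skips-multiple k m) ⟩
        n + m                          ∎)))
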